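{- Let $G_1$ and $G_2$ be two disjoint $(k+1)$-critical hypergraphs with $k\ge2$, let $\tilde e\in E(G_1)$ and $\tilde v\in V(G_2)$ be arbitrary, and let $s$ be an admissible map for $(\tilde e,G_2,\tilde v)$. Let $G=S(G_1,\tilde e,G_2,\tilde v,s)$ and $G_2'=G[(V(G_2)\setminus\{\tilde v\})\cup\tilde e]$. Assume that for every $k$-coloring $\varphi$ of $G[\tilde e]$ with $|\varphi(\tilde e)|\ge2$ there is a $k$-coloring $\varphi'$ of $G_2'$ whose restriction to $\tilde e$ equals $\varphi$. Then $G$ is $(k+1)$-critical.
   Context: A hypergraph is a pair $G=(V,E)$ of finite sets with $E\subseteq 2^V$ and $|e|\ge2$ for all $e\in E$. A $k$-coloring is a map $V\to\{1,\dots,k\}$ such that every edge contains two vertices of different colors; $\chi$ is the chromatic number. $G$ is $(k+1)$-critical if $\chi(G)=k+1$ but $\chi(H)\le k$ for every proper subhypergraph $H$. $G[X]$ has vertex set $X$ and the edges of $G$ contained in $X$. $\partial_G(v)$ is the set of edges containing $v$. Splitting: let $G_1,G_2$ be disjoint hypergraphs, $\tilde e\in E(G_1)$, $\tilde v\in V(G_2)$, and $s:\partial_{G_2}(\tilde v)\to 2^{\tilde e}$ a map (called admissible) with $s(e)\ne\varnothing$ for all $e$ and $\bigcup_{e}s(e)=\tilde e$. Then $S(G_1,\tilde e,G_2,\tilde v,s)$ is the hypergraph with vertex set $V(G_1)\cup(V(G_2)\setminus\{\tilde v\})$ and edge set $(E(G_1)\setminus\{\tilde e\})\cup(E(G_2)\setminus\partial_{G_2}(\tilde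 v))\cup\{(e\setminus\{\tilde v\})\cup s(e): e\in\partial_{G_2}(\tilde v)\}$. -}

module Defs where

open import Data.Fin.Base using (Fin; zero; suc)
import Data.Fin.Properties as Fin
open import Data.Fin.Subset
  using (Subset; inside; outside; _∈_; _∉_; _⊆_; _∪_; _∩_; _-_; ∣_∣; ⁅_⁆; Nonempty; Empty)
open import Data.Fin.Subset.Properties
  using ( _∈?_; _⊆?_; anySubset?; x∈p⇒∣p-x∣<∣p∣; x∈p∧x≢y⇒x∈p-y; p⊆q⇒∣p∣≤∣q∣; ∣⁅x⁆∣≡1; x∈⁅x⁆
        ; x∈⁅y⁆⇒x≡y; p─q⊆p; p⊆p∪q; q⊆p∪q; x∈p∪q⁻; x∈p∪q⁺; x∈p∩q⁺)
open import Data.Nat.Base using (ℕ; zero; suc; _≤_; z≤n; s≤s)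
import Data.Nat.Properties as ℕ
open import Data.Product.Base using (∃; ∃₂; _×_; _,_; proj₁; proj₂; map₂)
open import Data.Sum.Base using (_⊎_; inj₁; inj₂; [_,_])
import Data.Bool.Properties as Bool
open import Data.Vec.Base using ([]; _∷_; tabulate; here; there)
import Data.Vec.Properties as Vec
open import Function.Base using (_∘_)
open import Relation.Binary.PropositionalEquality
  using (_≡_; _≢_; _≗_; refl; sym; trans; subst)
open import Relation.Nullary
  using (Dec; does; yes; no; ¬_; ¬?; _×-dec_; _⊎-dec_; contradiction)
open import Relation.Nullary.Decidable using (map′; decidable-stable)
open import Relation.Unary using (Pred; Decidable)
open import Level using (0ℓ)

private
  variable
    n k : ℕ

------------------------------------------------------------------------
-- Two-element subsets

∣p∣≥2⇒other : (p : Subset n) → 2 ≤ ∣ p ∣ → ∀ x → ∃ λ y → y ∈ p × y ≢ x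
∣p∣≥2⇒other p 2≤ x with Fin.any? (λ y → (y ∈? p) ×-dec ¬? (y Fin.≟ x))
... | yes found = found
... | no  none  = contradiction 2≤ (ℕ.<⇒≱ (s≤s ∣p∣≤1))
  where
  p⊆⁅x⁆ : p ⊆ ⁅ x ⁆
  p⊆⁅x⁆ {y} y∈p with y Fin.≟ x
  ... | yes refl = x∈⁅x⁆ x
  ... | no  y≢x  = contradiction (y , y∈p , y≢x) none

  ∣p∣≤1 : ∣ p ∣ ≤ 1
  ∣p∣≤1 = subst (∣ p ∣ ≤_) (∣⁅x⁆∣≡1 x) (p⊆q⇒∣p∣≤∣q∣ p⊆⁅x⁆)

∣p∣≥2⇒pair : (p : Subset n) → 2 ≤ ∣ p ∣ → ∃₂ λ x y → x ∈ p × y ∈ p × x ≢ y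
∣p∣≥2⇒pair {suc n} p 2≤ with ∣p∣≥2⇒other p 2≤ zero
... | x , x∈p , _ with ∣p∣≥2⇒other p 2≤ x
...   | y , y∈p , y≢x = x , y , x∈p , y∈p , y≢x ∘ sym
∣p∣≥2⇒pair {zero} [] ()

pair⇒∣p∣≥2 : ∀ {p : Subset n} {x y} → x ∈ p → y ∈ p → x ≢ y → 2 ≤ ∣ p ∣
pair⇒∣p∣≥2 x∈p y∈p x≢y = ℕ.≤-trans
  (s≤s (ℕ.≤-trans (s≤s z≤n) (x∈p⇒∣p-x∣<∣p∣ (x∈p∧x≢y⇒x∈p-y y∈p (x≢y ∘ sym)))))
  (x∈p⇒∣p-x∣<∣p∣ x∈p)

------------------------------------------------------------------------
-- Elements of a subset, and maps defined only on those elements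

Elem : Subset n → Set
Elem X = ∃ λ x → x ∈ X

restrict : ∀ {X Y : Subset n} {A : Set} → X ⊆ Y → (Elem Y → A) → Elem X → A
restrict X⊆Y f = f ∘ map₂ X⊆Y

anyElem? : (X : Subset n) {P : Pred (Elem X) 0ℓ} → Decidable P → Dec (∃ P)
anyElem? []            P? = no λ ()
anyElem? (outside ∷ X) P? = map′
  (λ { ((x , x∈X) , Px) → (suc x , there x∈X) , Px })
  (λ { ((suc x , there x∈X) , Px) → (x , x∈X) , Px })
  (anyElem? X (λ (x , x∈X) → P? (suc x , there x∈X)))
anyElem? (inside ∷ X)  P? = map′
  [ (λ P₀ → (zero , here) , P₀)
  , (λ { ((x , x∈X) , Px) → (suc x , there x∈X) , Px }) ]
  (λ { ((zero , here) , P₀) → inj₁ P₀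
     ; ((suc x , there x∈X) , Px) → inj₂ ((x , x∈X) , Px) })
  (P? (zero , here) ⊎-dec anyElem? X (λ (x , x∈X) → P? (suc x , there x∈X)))

image : {X : Subset n} → (Elem X → Fin k) → Subset k
image {X = X} f = tabulate λ c → does (anyElem? X (λ x → f x Fin.≟ c))

anyMap? : (X : Subset n) {P : Pred (Elem X → Fin k) 0ℓ} →
          (∀ {f g} → f ≗ g → P f → P g) → Decidable P → Dec (∃ P)
anyMap? {k = k} [] resp P? = map′
  (λ P₀ → empty , P₀)
  (λ (f , Pf) → resp (λ ()) Pf)
  (P? empty)
  where
  empty : Elem [] → Fin k
  empty ()
anyMap? {k = k} (outside ∷ X) {P} resp P? = map′
  (λ (f , Pf) → extend f , Pf)
  (λ (f , Pf) → (λ (x , x∈X) → f (suc x , there x∈X)) ,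
                resp (λ { (suc x , there x∈X) → refl }) Pf)
  (anyMap? X
    (λ f≗g → resp (λ { (suc x , there x∈X) → f≗g (x , x∈X) }))
    (P? ∘ extend))
  where
  extend : (Elem X → Fin k) → Elem (outside ∷ X) → Fin k
  extend f (suc x , there x∈X) = f (x , x∈X)
anyMap? {k = k} (inside ∷ X) {P} resp P? = map′
  (λ (c , f , Pf) → extend c f , Pf)
  (λ (f , Pf) → f (zero , here) , (λ (x , x∈X) → f (suc x , there x∈X)) ,
                resp (λ { (zero , here) → refl ; (suc x , there x∈X) → refl }) Pf)
  (Fin.any? λ c → anyMap? X
    (λ f≗g → resp (λ { (zero , here) → refl ; (suc x , there x∈X) → f≗g (x , x∈X) }))
    (P? ∘ extend c))
  where
  extend : Fin k → (Elem X → Fin k) → Elem (inside ∷ X) → Fin k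
  extend c f (zero  , here)      = c
  extend c f (suc x , there x∈X) = f (x , x∈X)

------------------------------------------------------------------------
-- Hypergraphs

-- A finite hypergraph whose vertices are drawn from the ambient set Fin n.
-- The vertex set V may be any subset, so that disjoint hypergraphs,
-- subhypergraphs and splittings all live over the same ambient set.
record Hypergraph (n : ℕ) : Set₁ where
  field
    V     : Subset n
    E     : Pred (Subset n) 0ℓ
    E?    : Decidable E
    E⊆V   : ∀ {e} → E e → e ⊆ V
    ∣e∣≥2 : ∀ {e} → E e → 2 ≤ ∣ e ∣

open Hypergraph public

Disjoint : Hypergraph n → Hypergraph n → Set
Disjoint G₁ G₂ = Empty (V G₁ ∩ V G₂)

infix 4 _⊆ᴴ_ _⊂ᴴ_

_⊆ᴴ_ : Hypergraph n → Hypergraph n → Set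
H ⊆ᴴ G = V H ⊆ V G × (∀ {e} → E H e → E G e)

_⊂ᴴ_ : Hypergraph n → Hypergraph n → Set
H ⊂ᴴ G = H ⊆ᴴ G × ¬ (G ⊆ᴴ H)

∂ : Hypergraph n → Fin n → Pred (Subset n) 0ℓ
∂ G v e = E G e × v ∈ e

∂? : (G : Hypergraph n) (v : Fin n) → Decidable (∂ G v)
∂? G v e = E? G e ×-dec v ∈? e

infix 8 _[_]

_[_] : Hypergraph n → Subset n → Hypergraph n
G [ X ] = record
  { V     = X
  ; E     = λ e → E G e × e ⊆ X
  ; E?    = λ e → E? G e ×-dec e ⊆? X
  ; E⊆V   = proj₂
  ; ∣e∣≥2 = ∣e∣≥2 G ∘ proj₁
  }

------------------------------------------------------------------------
-- Colorings and the chromatic number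

Proper : (G : Hypergraph n) → (Elem (V G) → Fin k) → Set
Proper G f = ∀ e → E G e →
  ∃₂ λ (x y : Elem (V G)) → proj₁ x ∈ e × proj₁ y ∈ e × f x ≢ f y

record Coloring (k : ℕ) (G : Hypergraph n) : Set where
  field
    color  : Elem (V G) → Fin k
    proper : Proper G color

open Coloring public

proper? : (G : Hypergraph n) → Decidable (Proper {k = k} G)
proper? G f = map′
  (λ none e Ge → decidable-stable (split? e) (λ ¬split → none (e , Ge , ¬split)))
  (λ prop (e , Ge , ¬split) → ¬split (prop e Ge))
  (¬? (anySubset? λ e → E? G e ×-dec ¬? (split? e)))
  where
  split? : ∀ e → Dec (∃₂ λ (x y : Elem (V G)) → proj₁ x ∈ e × proj₁ y ∈ e × f x ≢ f y)
  split? e = anyElem? (V G) λ x → anyElem? (V G) λ y →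
    proj₁ x ∈? e ×-dec proj₁ y ∈? e ×-dec ¬? (f x Fin.≟ f y)

coloring? : (G : Hypergraph n) → Decidable λ k → Coloring k G
coloring? G k = map′
  (λ (f , prop) → record { color = f ; proper = prop })
  (λ φ → color φ , proper φ)
  (anyMap? (V G) resp (proper? G))
  where
  resp : ∀ {f g} → f ≗ g → Proper G f → Proper G g
  resp f≗g prop e Ge with prop e Ge
  ... | x , y , x∈e , y∈e , fx≢fy =
    x , y , x∈e , y∈e , λ gx≡gy → fx≢fy (trans (f≗g x) (trans gx≡gy (sym (f≗g y))))

discrete : (G : Hypergraph n) → Coloring n G
discrete G = record
  { color  = proj₁
  ; proper = λ e Ge → let x , y , x∈e , y∈e , x≢y = ∣p∣≥2⇒pair e (∣e∣≥2 G Ge) in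
      (x , E⊆V G Ge x∈e) , (y , E⊆V G Ge y∈e) , x∈e , y∈e , x≢y
  }

least : {P : Pred ℕ 0ℓ} → Decidable P → ∀ m → P m →
        ∃ λ l → P l × (∀ j → P j → l ≤ j)
least P? m Pm with P? zero
least P? m       Pm | yes P₀ = zero , P₀ , λ _ _ → z≤n
least P? zero    Pm | no ¬P₀ = contradiction Pm ¬P₀
least P? (suc m) Pm | no ¬P₀ with least (P? ∘ suc) m Pm
... | l , Pl , min = suc l , Pl , λ { zero P₀ → contradiction P₀ ¬P₀
                                    ; (suc j) Pj → s≤s (min j Pj) }

chromatic : (G : Hypergraph n) →
            ∃ λ l → Coloring l G × (∀ j → Coloring j G → l ≤ j)
chromatic {n} G = least (coloring? G) n (discrete G)

χ : Hypergraph n → ℕ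
χ G = proj₁ (chromatic G)

[1+_]-Critical : ℕ → Hypergraph n → Set₁
[1+ k ]-Critical G = χ G ≡ suc k × (∀ H → H ⊂ᴴ G → χ H ≤ k)

------------------------------------------------------------------------
-- Splitting

-- The map s is taken on all subsets, but only its values on ∂ G₂ ṽ matter.
record Admissible (ẽ : Subset n) (G₂ : Hypergraph n) (ṽ : Fin n)
                  (s : Subset n → Subset n) : Set where
  field
    s⊆ẽ      : ∀ {e} → ∂ G₂ ṽ e → s e ⊆ ẽ
    nonempty : ∀ {e} → ∂ G₂ ṽ e → Nonempty (s e)
    covers   : ∀ {x} → x ∈ ẽ → ∃ λ e → ∂ G₂ ṽ e × x ∈ s e

module _ (G₁ : Hypergraph n) (ẽ : Subset n) (G₂ : Hypergraph n) (ṽ : Fin n)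
         (s : Subset n → Subset n) where

  SplitEdge : Pred (Subset n) 0ℓ
  SplitEdge e = (E G₁ e × e ≢ ẽ)
              ⊎ (E G₂ e × ¬ ∂ G₂ ṽ e)
              ⊎ (∃ λ d → ∂ G₂ ṽ d × e ≡ (d - ṽ) ∪ s d)

  splitEdge? : Decidable SplitEdge
  splitEdge? e = (E? G₁ e ×-dec ¬? (e ≟ ẽ))
    ⊎-dec (E? G₂ e ×-dec ¬? (∂? G₂ ṽ e))
    ⊎-dec anySubset? (λ d → ∂? G₂ ṽ d ×-dec (e ≟ ((d - ṽ) ∪ s d)))
    where
    _≟_ = Vec.≡-dec Bool._≟_

  S : Disjoint G₁ G₂ → E G₁ ẽ → Admissible ẽ G₂ ṽ s → Hypergraph n
  S disjoint ẽ∈E₁ adm = record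
    { V     = V G₁ ∪ (V G₂ - ṽ)
    ; E     = SplitEdge
    ; E?    = splitEdge?
    ; E⊆V   = ⊆V
    ; ∣e∣≥2 = ≥2
    }
    where
    open Admissible adm

    ⊆V : ∀ {e} → SplitEdge e → e ⊆ V G₁ ∪ (V G₂ - ṽ)
    ⊆V (inj₁ (e∈E₁ , _)) x∈e = p⊆p∪q _ (E⊆V G₁ e∈E₁ x∈e)
    ⊆V (inj₂ (inj₁ (e∈E₂ , e∉∂))) x∈e =
      q⊆p∪q (V G₁) _ (x∈p∧x≢y⇒x∈p-y (E⊆V G₂ e∈E₂ x∈e)
        λ { refl → e∉∂ (e∈E₂ , x∈e) })
    ⊆V (inj₂ (inj₂ (d , d∈∂ , refl))) {x} x∈e with x∈p∪q⁻ (d - ṽ) (s d) x∈e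
    ... | inj₂ x∈s = p⊆p∪q _ (E⊆V G₁ ẽ∈E₁ (s⊆ẽ d∈∂ x∈s))
    ... | inj₁ x∈d-ṽ = q⊆p∪q (V G₁) _
      (x∈p∧x≢y⇒x∈p-y (E⊆V G₂ (proj₁ d∈∂) (p─q⊆p d ⁅ ṽ ⁆ x∈d-ṽ))
        λ { refl → x∉p-x d x∈d-ṽ })
      where
      x∉p-x : ∀ {m} {x : Fin m} (p : Subset m) → x ∉ p - x
      x∉p-x {x = zero}  (_ ∷ p) ()
      x∉p-x {x = suc x} (_ ∷ p) (there x∈) = x∉p-x p x∈

    ≥2 : ∀ {e} → SplitEdge e → 2 ≤ ∣ e ∣
    ≥2 (inj₁ (e∈E₁ , _))        = ∣e∣≥2 G₁ e∈E₁
    ≥2 (inj₂ (inj₁ (e∈E₂ , _))) = ∣e∣≥2 G₂ e∈E₂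
    ≥2 (inj₂ (inj₂ (d , d∈∂ , refl)))
      with ∣p∣≥2⇒other d (∣e∣≥2 G₂ (proj₁ d∈∂)) ṽ | nonempty d∈∂
    ... | x , x∈d , x≢ṽ | y , y∈s = pair⇒∣p∣≥2
      (p⊆p∪q (s d) (x∈p∧x≢y⇒x∈p-y x∈d x≢ṽ))
      (q⊆p∪q (d - ṽ) (s d) y∈s)
      λ { refl → disjoint (x , x∈p∩q⁺
            (E⊆V G₁ ẽ∈E₁ (s⊆ẽ d∈∂ y∈s) , E⊆V G₂ (proj₁ d∈∂) x∈d)) }

{-# OPTIONS --safe #-}

-- A k-coloring of G would make ẽ monochromatic, as G₁ is not k-colorable, and
-- giving that color to ṽ would color G₂.  For criticality it suffices to color G
-- minus one edge.  If the edge comes from G₁, a coloring of G₁ minus that edge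
-- splits ẽ, and the hypothesis extends it over G₂′.  If it comes from G₂, a
-- coloring of G₁ − ẽ is constant on ẽ, and a coloring of G₂ minus the edge, with
-- its colors permuted so that ṽ gets that constant, can be glued to it.
module Submission where

open import Defs
import Data.Bool.Properties as Bool
open import Data.Bool.Base using (if_then_else_)
open import Data.Empty using (⊥-elim)
open import Data.Fin.Base using (Fin; zero; suc; inject≤)
open import Data.Fin.Permutation using (_⟨$⟩ʳ_; transpose)
open import Data.Fin.Properties as Fin using (suc-injective; inject≤-injective)
open import Data.Fin.Subset using (Subset; _∈_; _∉_; _⊆_; _∪_; _-_; ∣_∣; ⁅_⁆)
open import Data.Fin.Subset.Properties
  using ( q⊆p∪q; p⊆p∪q; _∈?_; anySubset?; p─q⊆p; x∈p∧x≢y⇒x∈p-y; x∈p∪q⁻; x∈p∪q⁺; x∈p∩q⁺ )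
open import Data.Nat.Base using (ℕ; suc; _≤_; s≤s)
import Data.Nat.Properties as ℕ
open import Data.Product.Base using (∃; ∃₂; _×_; _,_; proj₁; proj₂)
open import Data.Sum.Base using (inj₁; inj₂)
open import Data.Vec.Base using (_∷_; there)
open import Data.Vec.Functional using (updateAt)
open import Data.Vec.Functional.Properties using (updateAt-updates; updateAt-minimal)
open import Data.Vec.Properties as Vec using (lookup∘tabulate; lookup⇒[]=)
open import Data.Vec.Properties.WithK using ([]=-irrelevant)
open import Function.Base using (_∘_; const)
open import Function.Bundles using (Injection)
open import Function.Properties.Inverse using (↔⇒↣)
open import Relation.Binary.Definitions using (DecidableEquality)
open import Relation.Binary.PropositionalEquality
  using (_≡_; _≢_; _≗_; refl; sym; trans; cong)
open import Relation.Nullary using (¬_; ¬?; yes; no; does; contradiction; _×-dec_)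
open import Relation.Nullary.Decidable using (decidable-stable; dec-true; dec-false)

private
  variable
    n j k : ℕ

_≟_ : DecidableEquality (Subset n)
_≟_ = Vec.≡-dec Bool._≟_

x∈p-y⇒x≢y : ∀ {x y : Fin n} (p : Subset n) → x ∈ p - y → x ≢ y
x∈p-y⇒x≢y {x = suc x} (_ ∷ p) (there x∈) refl = x∈p-y⇒x≢y p x∈ refl

∈-image : ∀ {X : Subset n} (f : Elem X → Fin k) x → f x ∈ image f
∈-image f x = lookup⇒[]= (f x) _
  (trans (lookup∘tabulate _ (f x)) (dec-true (anyElem? _ _) (x , refl)))

-- Total colorings

Split : {A : Set} → (Fin n → A) → Subset n → Set
Split f e = ∃₂ λ x y → x ∈ e × y ∈ e × f x ≢ f y

-- Two differently colored vertices of `d` are carried to vertices of `e` with the same two colors.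
-- Passing between an edge of `G₂` and its counterpart in the splitting is an instance.
Split-map : ∀ {A : Set} {f g : Fin n → A} {d e} →
            (∀ {x} → x ∈ d → ∃ λ y → y ∈ e × g y ≡ f x) → Split f d → Split g e
Split-map ρ (x , y , x∈d , y∈d , fx≢fy) with ρ x∈d | ρ y∈d
... | x′ , x′∈e , gx′≡fx | y′ , y′∈e , gy′≡fy =
  x′ , y′ , x′∈e , y′∈e , λ eq → fx≢fy (trans (sym gx′≡fx) (trans eq gy′≡fy))

Split-cong : ∀ {A : Set} {f g : Fin n → A} {e} →
             (∀ {x} → x ∈ e → g x ≡ f x) → Split f e → Split g e
Split-cong g≗f = Split-map λ {x} x∈e → x , x∈e , g≗f x∈e

Split-∘ : ∀ {A B : Set} {f : Fin n → A} {e} {π : A → B} →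
          (∀ {a b} → π a ≡ π b → a ≡ b) → Split f e → Split (π ∘ f) e
Split-∘ inj (x , y , x∈e , y∈e , fx≢fy) = x , y , x∈e , y∈e , fx≢fy ∘ inj

¬Split⇒constant : ∀ {f : Fin n → Fin k} {e x y} → ¬ Split f e → x ∈ e → y ∈ e → f x ≡ f y
¬Split⇒constant {f = f} {x = x} {y} ¬split x∈e y∈e =
  decidable-stable (f x Fin.≟ f y) λ fx≢fy → ¬split (x , y , x∈e , y∈e , fx≢fy)

-- Using functions on the whole ambient set lets one function be tested against hypergraphs with
-- different vertex sets; its values off `V G` do not matter.
Colors : {A : Set} → (Fin n → A) → Hypergraph n → Set
Colors f G = ∀ {e} → E G e → Split f e

fromTotal : (G : Hypergraph n) {f : Fin n → Fin k} → Colors f G → Coloring k G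
fromTotal G {f} col = record
  { color  = f ∘ proj₁
  ; proper = λ e Ge → let x , y , x∈e , y∈e , fx≢fy = col Ge in
      (x , E⊆V G Ge x∈e) , (y , E⊆V G Ge y∈e) , x∈e , y∈e , fx≢fy
  }

extend : {X : Subset n} → Fin k → (Elem X → Fin k) → Fin n → Fin k
extend {X = X} c f x with x ∈? X
... | yes x∈X = f (x , x∈X)
... | no  _   = c

extend-∈ : ∀ {X : Subset n} {c : Fin k} (f : Elem X → Fin k) {x} (x∈X : x ∈ X) →
           extend c f x ≡ f (x , x∈X)
extend-∈ {X = X} f {x} x∈X with x ∈? X
-- `f` receives the membership proof as well, so the two proofs must be identified.
... | yes x∈X′ = cong (λ p → f (x , p)) ([]=-irrelevant x∈X′ x∈X)
... | no  x∉X  = contradiction x∈X x∉X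

toTotal : (G : Hypergraph n) (c : Fin k) (φ : Coloring k G) → Colors (extend c (color φ)) G
toTotal G c φ {e} Ge with proper φ e Ge
... | (x , x∈V) , (y , y∈V) , x∈e , y∈e , fx≢fy = x , y , x∈e , y∈e , λ eq →
  fx≢fy (trans (sym (extend-∈ (color φ) x∈V)) (trans eq (extend-∈ (color φ) y∈V)))

weaken : {G : Hypergraph n} → j ≤ k → Coloring j G → Coloring k G
weaken j≤k φ = record
  { color  = λ x → inject≤ (color φ x) j≤k
  ; proper = λ e Ge → let x , y , x∈e , y∈e , fx≢fy = proper φ e Ge in
      x , y , x∈e , y∈e , fx≢fy ∘ inject≤-injective j≤k j≤k _ _
  }

Coloring⇒χ≤ : (G : Hypergraph n) → Coloring k G → χ G ≤ k
Coloring⇒χ≤ {k = k} G = proj₂ (proj₂ (chromatic G)) k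

χ≤⇒Coloring : (G : Hypergraph n) → χ G ≤ k → Coloring k G
χ≤⇒Coloring G χ≤k = weaken χ≤k (proj₁ (proj₂ (chromatic G)))

-- Critical hypergraphs

infixl 8 _∖_

_∖_ : Hypergraph n → Subset n → Hypergraph n
G ∖ e = record
  { V     = V G
  ; E     = λ d → E G d × d ≢ e
  ; E?    = λ d → E? G d ×-dec ¬? (d ≟ e)
  ; E⊆V   = E⊆V G ∘ proj₁
  ; ∣e∣≥2 = ∣e∣≥2 G ∘ proj₁
  }

Colors-∖ : ∀ (G : Hypergraph n) {A : Set} {f : Fin n → A} {e} →
           Colors f (G ∖ e) → Split f e → Colors f G
Colors-∖ G {e = e} col split {d} Gd with d ≟ e
... | yes refl = split
... | no  d≢e  = col (Gd , d≢e)

-- The color `c` is the default value at ambient points that are not vertices.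
module Critical {G : Hypergraph n} (c : Fin k) (crit : [1+ k ]-Critical G) where

  uncolorable : {f : Fin n → Fin k} → ¬ Colors f G
  uncolorable col =
    ℕ.<⇒≱ (ℕ.≤-reflexive (sym (proj₁ crit))) (Coloring⇒χ≤ G (fromTotal G col))

  color-⊂ : ∀ H → H ⊂ᴴ G → ∃ λ (f : Fin n → Fin k) → Colors f H
  color-⊂ H H⊂G = _ , toTotal H c (χ≤⇒Coloring H (proj₂ crit H H⊂G))

  color-∖ : ∀ {e} → E G e → ∃ λ (f : Fin n → Fin k) → Colors f (G ∖ e)
  color-∖ {e} Ge = color-⊂ (G ∖ e)
    (((λ x∈V → x∈V) , proj₁) , λ (_ , G⊆) → proj₂ (G⊆ Ge) refl)

  ¬splits-removed : ∀ {e} {f : Fin n → Fin k} → Colors f (G ∖ e) → ¬ Split f e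
  ¬splits-removed col = uncolorable ∘ Colors-∖ G col

  -- Otherwise a coloring of `G ∖ e` would split `d`, hence also the larger set `e`, and so color
  -- `G`.
  antichain : ∀ {d e} → E G d → E G e → d ⊆ e → d ≡ e
  antichain {d} {e} Gd Ge d⊆e = decidable-stable (d ≟ e) λ d≢e →
    let _ , col = color-∖ Ge in
    ¬splits-removed col (Split-map (λ {x} x∈d → x , d⊆e x∈d , refl) (col (Gd , d≢e)))

  -- If no edge contained `v`, deleting `v` would lose no edge, and a coloring of the rest would
  -- color `G`.
  incident : ∀ {v} → v ∈ V G → ∃ (∂ G v)
  incident {v} v∈V with anySubset? (∂? G v)
  ... | yes found = found
  ... | no  none  = contradiction (λ {e} → col′ {e}) uncolorable
    where
    H = G [ V G - v ]

    H⊂G : H ⊂ᴴ G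
    H⊂G = (p─q⊆p _ _ , proj₁) , λ (V⊆ , _) → x∈p-y⇒x≢y (V G) (V⊆ v∈V) refl

    col′ : Colors (proj₁ (color-⊂ H H⊂G)) G
    col′ Ge = proj₂ (color-⊂ H H⊂G) (Ge , λ x∈e →
      x∈p∧x≢y⇒x∈p-y (E⊆V G Ge x∈e) λ { refl → none (_ , Ge , x∈e) })

-- A criterion for criticality by deleting single edges

module _ (G : Hypergraph n)
         (uncolorable : {f : Fin n → Fin k} → ¬ Colors f G)
         (incident : ∀ {v} → v ∈ V G → ∃ (∂ G v))
         (color-∖ : ∀ {e} → E G e → ∃ λ (f : Fin n → Fin k) → Colors f (G ∖ e))
         where

  -- A vertex of e gets a fresh color on top of a k-coloring of G ∖ e.
  suc-colorable : ∀ {e} → E G e → ∃ λ (f : Fin n → Fin (suc k)) → Colors f G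
  suc-colorable {e} Ge = g , col
    where
    f = proj₁ (color-∖ Ge)
    v = proj₁ (∣p∣≥2⇒pair e (∣e∣≥2 G Ge))
    v∈e = proj₁ (proj₂ (proj₂ (∣p∣≥2⇒pair e (∣e∣≥2 G Ge))))
    g = updateAt (suc ∘ f) v (const zero)

    g-v : g v ≡ zero
    g-v = updateAt-updates v (suc ∘ f)

    g-≢ : ∀ {x} → x ≢ v → g x ≡ suc (f x)
    g-≢ {x} = updateAt-minimal x v (suc ∘ f)

    col : Colors g G
    col {d} Gd with v ∈? d
    ... | yes v∈d with ∣p∣≥2⇒other d (∣e∣≥2 G Gd) v
    ...   | x , x∈d , x≢v = v , x , v∈d , x∈d , λ eq →
      Fin.0≢1+n (trans (sym g-v) (trans eq (g-≢ x≢v)))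
    -- Since `v ∈ e`, an edge avoiding `v` differs from `e` and is already split by `f`.
    col {d} Gd | no v∉d = Split-cong (λ x∈d → g-≢ λ { refl → v∉d x∈d })
      (Split-∘ suc-injective (proj₂ (color-∖ Ge) (Gd , λ { refl → v∉d v∈e })))

  critical : ∃ (E G) → Fin k → [1+ k ]-Critical G
  critical (e , Ge) c = ℕ.≤-antisym
    (Coloring⇒χ≤ G (fromTotal G (proj₂ (suc-colorable Ge))))
    (ℕ.≰⇒> λ χ≤k → uncolorable (toTotal G c (χ≤⇒Coloring G χ≤k)))
    , χ-⊂
    where
    χ-⊂ : ∀ H → H ⊂ᴴ G → χ H ≤ k
    χ-⊂ H ((V⊆ , E⊆) , G⊈H) with anySubset? (λ e → E? G e ×-dec ¬? (E? H e))
    ... | yes (e , Ge , ¬He) = Coloring⇒χ≤ H (fromTotal H λ Hd →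
      proj₂ (color-∖ Ge) (E⊆ Hd , λ { refl → ¬He Hd }))
    -- With all edges of `G` present, `H` also has all vertices, as each lies on an edge; so `H` is
    -- not proper.
    ... | no none = ⊥-elim (G⊈H (V⊇ , E⊇))
      where
      E⊇ : ∀ {e} → E G e → E H e
      E⊇ {e} Ge = decidable-stable (E? H e) λ ¬He → none (e , Ge , ¬He)

      V⊇ : V G ⊆ V H
      V⊇ v∈V = let _ , Ge , v∈e = incident v∈V in E⊆V H (E⊇ Ge) v∈e

-- Splitting

module Splitting (G₁ G₂ : Hypergraph n) (disjoint : Disjoint G₁ G₂)
                 (ẽ : Subset n) (ẽ∈E₁ : E G₁ ẽ) (ṽ : Fin n)
                 (s : Subset n → Subset n) (adm : Admissible ẽ G₂ ṽ s) where

  open Admissible adm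

  G : Hypergraph n
  G = S G₁ ẽ G₂ ṽ s disjoint ẽ∈E₁ adm

  ẽ⊆V₁ : ẽ ⊆ V G₁
  ẽ⊆V₁ = E⊆V G₁ ẽ∈E₁

  V₂∌V₁ : ∀ {x} → x ∈ V G₂ → x ∉ V G₁
  V₂∌V₁ x∈V₂ x∈V₁ = disjoint (_ , x∈p∩q⁺ (x∈V₁ , x∈V₂))

  glue : (f₁ f₂ : Fin n → Fin k) → Fin n → Fin k
  glue f₁ f₂ x = if does (x ∈? V G₁) then f₁ x else f₂ x

  glue-V₁ : (f₁ f₂ : Fin n → Fin k) → ∀ {x} → x ∈ V G₁ → glue f₁ f₂ x ≡ f₁ x
  glue-V₁ f₁ f₂ {x} x∈V₁ rewrite dec-true (x ∈? V G₁) x∈V₁ = refl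

  glue-V₂ : (f₁ f₂ : Fin n → Fin k) → ∀ {x} → x ∈ V G₂ → glue f₁ f₂ x ≡ f₂ x
  glue-V₂ f₁ f₂ {x} x∈V₂ rewrite dec-false (x ∈? V G₁) (V₂∌V₁ x∈V₂) = refl

  E₂-⊆V₂-ṽ : ∀ {d} → E G₂ d → ¬ ∂ G₂ ṽ d → d ⊆ V G₂ - ṽ
  E₂-⊆V₂-ṽ d∈E₂ d∉∂ x∈d =
    x∈p∧x≢y⇒x∈p-y (E⊆V G₂ d∈E₂ x∈d) λ { refl → d∉∂ (d∈E₂ , x∈d) }

  ∂-⊆V₂-ṽ : ∀ {d} → ∂ G₂ ṽ d → d - ṽ ⊆ V G₂ - ṽ
  ∂-⊆V₂-ṽ {d} (d∈E₂ , _) x∈ =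
    x∈p∧x≢y⇒x∈p-y (E⊆V G₂ d∈E₂ (p─q⊆p d ⁅ ṽ ⁆ x∈)) (x∈p-y⇒x≢y d x∈)

  lift-⊆ : ∀ {d} → ∂ G₂ ṽ d → (d - ṽ) ∪ s d ⊆ (V G₂ - ṽ) ∪ ẽ
  lift-⊆ {d} d∈∂ x∈ with x∈p∪q⁻ (d - ṽ) (s d) x∈
  ... | inj₁ x∈d = x∈p∪q⁺ (inj₁ (∂-⊆V₂-ṽ d∈∂ x∈d))
  ... | inj₂ x∈s = x∈p∪q⁺ (inj₂ (s⊆ẽ d∈∂ x∈s))

  V₂-ṽ∌ẽ : ∀ {x} → x ∈ V G₂ - ṽ → x ∉ ẽ
  V₂-ṽ∌ẽ x∈ = V₂∌V₁ (p─q⊆p (V G₂) ⁅ ṽ ⁆ x∈) ∘ ẽ⊆V₁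

  -- Any vertex of the nonempty set `s d` can stand in for `ṽ`, because all of `ẽ` has the color of
  -- `ṽ`.
  split-lift : ∀ {f g : Fin n → Fin k} {d} → ∂ G₂ ṽ d →
               (∀ {x} → x ∈ V G₂ - ṽ → g x ≡ f x) → (∀ {x} → x ∈ ẽ → g x ≡ f ṽ) →
               Split f d → Split g ((d - ṽ) ∪ s d)
  split-lift {f = f} {g} {d} d∈∂ g≗f g-ẽ = Split-map ρ
    where
    ρ : ∀ {x} → x ∈ d → ∃ λ y → y ∈ (d - ṽ) ∪ s d × g y ≡ f x
    ρ {x} x∈d with x Fin.≟ ṽ
    ... | no x≢ṽ = x , p⊆p∪q _ x∈d-ṽ , g≗f (∂-⊆V₂-ṽ d∈∂ x∈d-ṽ)
      where x∈d-ṽ = x∈p∧x≢y⇒x∈p-y x∈d x≢ṽ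
    ... | yes refl = let y , y∈s = nonempty d∈∂ in
      y , q⊆p∪q (d - ṽ) _ y∈s , g-ẽ (s⊆ẽ d∈∂ y∈s)

  -- Conversely, contracting the monochromatic set `ẽ` to `ṽ` loses no color.
  split-unlift : ∀ {f g : Fin n → Fin k} {d} → ∂ G₂ ṽ d →
                 (∀ {x} → x ≢ ṽ → f x ≡ g x) → (∀ {x} → x ∈ ẽ → g x ≡ f ṽ) →
                 Split g ((d - ṽ) ∪ s d) → Split f d
  split-unlift {f = f} {g} {d} d∈∂ f≗g g-ẽ = Split-map ρ
    where
    ρ : ∀ {x} → x ∈ (d - ṽ) ∪ s d → ∃ λ y → y ∈ d × f y ≡ g x
    ρ {x} x∈ with x∈p∪q⁻ (d - ṽ) (s d) x∈
    ... | inj₁ x∈d = x , p─q⊆p d ⁅ ṽ ⁆ x∈d , f≗g (x∈p-y⇒x≢y d x∈d)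
    ... | inj₂ x∈s = ṽ , proj₂ d∈∂ , sym (g-ẽ (s⊆ẽ d∈∂ x∈s))

  -- Uncolorability and absence of isolated vertices

  G-uncolorable : (∀ {f : Fin n → Fin k} → ¬ Colors f G₁) →
                  (∀ {f : Fin n → Fin k} → ¬ Colors f G₂) →
                  ∀ {g : Fin n → Fin k} → ¬ Colors g G
  G-uncolorable ¬col₁ ¬col₂ {g} col = ¬col₂ (λ {e} → col₂ {e})
    where
    u = proj₁ (∣p∣≥2⇒pair ẽ (∣e∣≥2 G₁ ẽ∈E₁))
    u∈ẽ = proj₁ (proj₂ (proj₂ (∣p∣≥2⇒pair ẽ (∣e∣≥2 G₁ ẽ∈E₁))))
    -- `ṽ` is not a vertex of `G`, so its color is free to be that of `u`, a representative of `ẽ`.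
    f = updateAt g ṽ (const (g u))

    f≗g : ∀ {x} → x ≢ ṽ → f x ≡ g x
    f≗g {x} = updateAt-minimal x ṽ g

    g-ẽ : ∀ {x} → x ∈ ẽ → g x ≡ f ṽ
    g-ẽ x∈ẽ = trans
      (¬Split⇒constant (¬col₁ ∘ Colors-∖ G₁ (col ∘ inj₁)) x∈ẽ u∈ẽ)
      (sym (updateAt-updates ṽ g))

    col₂ : Colors f G₂
    col₂ {d} d∈E₂ with ∂? G₂ ṽ d
    ... | yes d∈∂ = split-unlift d∈∂ f≗g g-ẽ (col (inj₂ (inj₂ (d , d∈∂ , refl))))
    ... | no  d∉∂ = Split-cong (f≗g ∘ x∈p-y⇒x≢y (V G₂) ∘ E₂-⊆V₂-ṽ d∈E₂ d∉∂)
                      (col (inj₂ (inj₁ (d∈E₂ , d∉∂))))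

  G-incident : (∀ {v} → v ∈ V G₁ → ∃ (∂ G₁ v)) → (∀ {v} → v ∈ V G₂ → ∃ (∂ G₂ v)) →
               ∀ {v} → v ∈ V G → ∃ (∂ G v)
  G-incident inc₁ inc₂ v∈V with x∈p∪q⁻ (V G₁) (V G₂ - ṽ) v∈V
  ... | inj₁ v∈V₁ with inc₁ v∈V₁
  ...   | e , e∈E₁ , v∈e with e ≟ ẽ
  ...     | no  e≢ẽ  = e , inj₁ (e∈E₁ , e≢ẽ) , v∈e
  -- `ẽ` itself is removed by the splitting, but the sets `s d` cover it, so a lifted edge contains
  -- `v`.
  ...     | yes refl = let d , d∈∂ , v∈s = covers v∈e in
    _ , inj₂ (inj₂ (d , d∈∂ , refl)) , q⊆p∪q (d - ṽ) _ v∈s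
  G-incident inc₁ inc₂ v∈V | inj₂ v∈V₂-ṽ with inc₂ (p─q⊆p (V G₂) ⁅ ṽ ⁆ v∈V₂-ṽ)
  ... | d , d∈E₂ , v∈d with ∂? G₂ ṽ d
  ...   | no  d∉∂ = d , inj₂ (inj₁ (d∈E₂ , d∉∂)) , v∈d
  ...   | yes d∈∂ = _ , inj₂ (inj₂ (d , d∈∂ , refl)) ,
    p⊆p∪q _ (x∈p∧x≢y⇒x∈p-y v∈d (x∈p-y⇒x≢y (V G₂) v∈V₂-ṽ))

  lift-⊈ẽ : ∀ {d} → ∂ G₂ ṽ d → ¬ (d - ṽ) ∪ s d ⊆ ẽ
  lift-⊈ẽ {d} d∈∂ ⊆ẽ = let x , x∈d , x≢ṽ = ∣p∣≥2⇒other d (∣e∣≥2 G₂ (proj₁ d∈∂)) ṽ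
                           x∈d-ṽ = x∈p∧x≢y⇒x∈p-y x∈d x≢ṽ in
    V₂-ṽ∌ẽ (∂-⊆V₂-ṽ d∈∂ x∈d-ṽ) (⊆ẽ (p⊆p∪q _ x∈d-ṽ))

  -- An edge of `G₁` inside `ẽ` would be `ẽ`, and every other edge has a vertex in `V G₂ - ṽ`. Hence
  -- any map on `ẽ` is a coloring of `G [ ẽ ]`, to which the extension hypothesis can be applied.
  G[ẽ]-edgeless : (∀ {d e} → E G₁ d → E G₁ e → d ⊆ e → d ≡ e) →
                  ∀ {e} → ¬ E (G [ ẽ ]) e
  G[ẽ]-edgeless anti (inj₁ (e∈E₁ , e≢ẽ) , e⊆ẽ) = e≢ẽ (anti e∈E₁ ẽ∈E₁ e⊆ẽ)
  G[ẽ]-edgeless anti {e} (inj₂ (inj₁ (e∈E₂ , e∉∂)) , e⊆ẽ) =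
    let x , _ , x∈e , _ = ∣p∣≥2⇒pair e (∣e∣≥2 G₂ e∈E₂) in
    V₂-ṽ∌ẽ (E₂-⊆V₂-ṽ e∈E₂ e∉∂ x∈e) (e⊆ẽ x∈e)
  G[ẽ]-edgeless anti (inj₂ (inj₂ (d , d∈∂ , refl)) , e⊆ẽ) = lift-⊈ẽ d∈∂ e⊆ẽ

  -- Coloring the splitting minus one edge

  remove-E₁ : Fin k → (∀ {d e} → E G₁ d → E G₁ e → d ⊆ e → d ≡ e) →
    (∀ (φ : Coloring k (G [ ẽ ])) → 2 ≤ ∣ image (color φ) ∣ →
      ∃ λ (φ′ : Coloring k (G [ (V G₂ - ṽ) ∪ ẽ ])) →
        restrict (q⊆p∪q (V G₂ - ṽ) ẽ) (color φ′) ≗ color φ) →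
    ∀ {e} {f : Fin n → Fin k} → e ≢ ẽ → Colors f (G₁ ∖ e) →
    ∃ λ (g : Fin n → Fin k) → Colors g (G ∖ e)
  remove-E₁ {k = k} c anti extends {e} {f} e≢ẽ col₁ = g , col
    where
    split-ẽ : Split f ẽ
    split-ẽ = col₁ (ẽ∈E₁ , e≢ẽ ∘ sym)

    φ : Coloring k (G [ ẽ ])
    φ = fromTotal (G [ ẽ ]) λ G[ẽ]e → contradiction G[ẽ]e (G[ẽ]-edgeless anti)

    φ-many : 2 ≤ ∣ image (color φ) ∣
    φ-many = let x , y , x∈ẽ , y∈ẽ , fx≢fy = split-ẽ in
      pair⇒∣p∣≥2 (∈-image (color φ) (x , x∈ẽ)) (∈-image (color φ) (y , y∈ẽ)) fx≢fy

    φ′ = proj₁ (extends φ φ-many)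
    f₂ = extend c (color φ′)
    g  = glue f f₂

    g≗f₂ : ∀ {x} → x ∈ (V G₂ - ṽ) ∪ ẽ → g x ≡ f₂ x
    g≗f₂ x∈ with x∈p∪q⁻ (V G₂ - ṽ) ẽ x∈
    ... | inj₁ x∈V₂ = glue-V₂ f f₂ (p─q⊆p (V G₂) ⁅ ṽ ⁆ x∈V₂)
    -- On the overlap `ẽ` the gluing takes `f`, which agrees with `f₂` there because `φ′` extends
    -- `φ`.
    ... | inj₂ x∈ẽ  = trans (glue-V₁ f f₂ (ẽ⊆V₁ x∈ẽ))
      (trans (sym (proj₂ (extends φ φ-many) (_ , x∈ẽ))) (sym (extend-∈ (color φ′) _)))

    split-G₂′ : ∀ {d} → E G d → d ⊆ (V G₂ - ṽ) ∪ ẽ → Split g d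
    split-G₂′ Gd d⊆ = Split-cong (g≗f₂ ∘ d⊆) (toTotal _ c φ′ (Gd , d⊆))

    col : Colors g (G ∖ e)
    col (inj₁ (d∈E₁ , _) , d≢e) =
      Split-cong (glue-V₁ f f₂ ∘ E⊆V G₁ d∈E₁) (col₁ (d∈E₁ , d≢e))
    col (Gd@(inj₂ (inj₁ (d∈E₂ , d∉∂))) , _) =
      split-G₂′ Gd (p⊆p∪q ẽ ∘ E₂-⊆V₂-ṽ d∈E₂ d∉∂)
    col (Gd@(inj₂ (inj₂ (d , d∈∂ , refl))) , _) = split-G₂′ Gd (lift-⊆ d∈∂)

  -- Here `d` is the edge missing from `G₂` and `e` its counterpart in `G`: either `d` itself or its
  -- lift. The last two conditions say that edges of `G` other than `e` do not come from `d`;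
  -- lifting need not be injective for this.
  remove-E₂ : ∀ {f₁ f₂ : Fin n → Fin k} {d e} → Colors f₁ (G₁ ∖ ẽ) → ¬ Split f₁ ẽ →
    Colors f₂ (G₂ ∖ d) →
    (∀ {a} → E G₂ a → ¬ ∂ G₂ ṽ a → a ≢ e → a ≢ d) →
    (∀ {a} → ∂ G₂ ṽ a → (a - ṽ) ∪ s a ≢ e → a ≢ d) →
    ∃ λ (g : Fin n → Fin k) → Colors g (G ∖ e)
  remove-E₂ {k = k} {f₁} {f₂} {d} {e} col₁ mono col₂ ≢d ≢d-lift = g , col
    where
    u = proj₁ (∣p∣≥2⇒pair ẽ (∣e∣≥2 G₁ ẽ∈E₁))
    u∈ẽ = proj₁ (proj₂ (proj₂ (∣p∣≥2⇒pair ẽ (∣e∣≥2 G₁ ẽ∈E₁))))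
    -- Swapping two colors keeps edges split and gives `ṽ` the constant color of `ẽ`.
    π  = transpose (f₂ ṽ) (f₁ u)
    h  = (π ⟨$⟩ʳ_) ∘ f₂
    g  = glue f₁ h

    h-ṽ : h ṽ ≡ f₁ u
    h-ṽ rewrite dec-true (f₂ ṽ Fin.≟ f₂ ṽ) refl = refl

    h-col : Colors h (G₂ ∖ d)
    h-col = Split-∘ (Injection.injective (↔⇒↣ π)) ∘ col₂

    g-V₂ : ∀ {x} → x ∈ V G₂ - ṽ → g x ≡ h x
    g-V₂ = glue-V₂ f₁ h ∘ p─q⊆p (V G₂) ⁅ ṽ ⁆

    g-ẽ : ∀ {x} → x ∈ ẽ → g x ≡ h ṽ
    g-ẽ x∈ẽ = trans (glue-V₁ f₁ h (ẽ⊆V₁ x∈ẽ))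
                (trans (¬Split⇒constant mono x∈ẽ u∈ẽ) (sym h-ṽ))

    col : Colors g (G ∖ e)
    col (inj₁ (a∈E₁ , a≢ẽ) , _) =
      Split-cong (glue-V₁ f₁ h ∘ E⊆V G₁ a∈E₁) (col₁ (a∈E₁ , a≢ẽ))
    col (inj₂ (inj₁ (a∈E₂ , a∉∂)) , a≢e) =
      Split-cong (g-V₂ ∘ E₂-⊆V₂-ṽ a∈E₂ a∉∂) (h-col (a∈E₂ , ≢d a∈E₂ a∉∂ a≢e))
    col (inj₂ (inj₂ (a , a∈∂ , refl)) , a≢e) =
      split-lift a∈∂ g-V₂ g-ẽ (h-col (proj₁ a∈∂ , ≢d-lift a∈∂ a≢e))

theorem17 : ∀ (n k : ℕ) → 2 ≤ k →
    (G₁ G₂ : Hypergraph n) (disjoint : Disjoint G₁ G₂) →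
    [1+ k ]-Critical G₁ → [1+ k ]-Critical G₂ →
    (ẽ : Subset n) (ẽ∈E₁ : E G₁ ẽ) (ṽ : Fin n) → ṽ ∈ V G₂ →
    (s : Subset n → Subset n) (adm : Admissible ẽ G₂ ṽ s) →
    let G   = S G₁ ẽ G₂ ṽ s disjoint ẽ∈E₁ adm
        G₂′ = G [ (V G₂ - ṽ) ∪ ẽ ]
    in
    (∀ (φ : Coloring k (G [ ẽ ])) → 2 ≤ ∣ image (color φ) ∣ →
      ∃ λ (φ′ : Coloring k G₂′) →
        restrict (q⊆p∪q (V G₂ - ṽ) ẽ) (color φ′) ≗ color φ) →
    [1+ k ]-Critical G
-- The bound on the number of colors makes it a successor, so `zero` is available as default color.
theorem17 n (suc k) (s≤s _) G₁ G₂ disjoint crit₁ crit₂ ẽ ẽ∈E₁ ṽ ṽ∈V₂ s adm extends =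
  critical G (G-uncolorable C₁.uncolorable C₂.uncolorable)
    (G-incident C₁.incident C₂.incident) color-∖ edge zero
  where
  open Splitting G₁ G₂ disjoint ẽ ẽ∈E₁ ṽ s adm
  module C₁ = Critical {G = G₁} zero crit₁
  module C₂ = Critical {G = G₂} zero crit₂

  edge : ∃ (E G)
  edge = let d , d∈∂ = C₂.incident ṽ∈V₂ in _ , inj₂ (inj₂ (d , d∈∂ , refl))

  color-∖ : ∀ {e} → E G e → ∃ λ (f : Fin n → Fin (suc k)) → Colors f (G ∖ e)
  color-∖ (inj₁ (e∈E₁ , e≢ẽ)) =
    remove-E₁ zero C₁.antichain extends e≢ẽ (proj₂ (C₁.color-∖ e∈E₁))
  color-∖ (inj₂ (inj₁ (e∈E₂ , e∉∂))) =
    let _ , col₁ = C₁.color-∖ ẽ∈E₁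
        _ , col₂ = C₂.color-∖ e∈E₂
    in remove-E₂ col₁ (C₁.¬splits-removed col₁) col₂
         -- The deleted edge avoids `ṽ`, so no lifted edge comes from it.
         (λ _ _ a≢e → a≢e) (λ { a∈∂ _ refl → e∉∂ a∈∂ })
  color-∖ (inj₂ (inj₂ (d , d∈∂ , refl))) =
    let _ , col₁ = C₁.color-∖ ẽ∈E₁
        _ , col₂ = C₂.color-∖ (proj₁ d∈∂)
    in remove-E₂ col₁ (C₁.¬splits-removed col₁) col₂
         (λ { _ a∉∂ _ refl → a∉∂ d∈∂ }) (λ { _ ≢e refl → ≢e refl })
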